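{- For every real $M\ge 1$, the abstract prearithmetic $\mathbf{A}_{ -M,M}=([-M,M],\boxplus,\boxtimes,\le)$ is weakly projective with respect to the real arithmetic $\mathbf{R}=(\mathbb{R},+,\times,\le)$, with projector $s:[-M,M]\to\mathbb{R}$, $s(a)=a$, and coprojector $t:\mathbb{R}\to[-M,M]$ given by $t(a)=a$ if $a\in[-M,M]$, $t(a)=M$ if $a>M$, and $t(a)=-M$ if $a<-M$.
   Context: An abstract prearithmetic is a tuple $\mathbf{A}=(A,+_A,\times_A,\le_A)$ where $A\subset\mathbb{R}$ is a set, $\le_A$ is a partial order on $A$, and $+_A,\times_A$ are binary operations on $A$. $\mathbf{A}$ is weakly projective with respect to $\mathbf{B}=(B,+_B,\times_B,\le_B)$, with projector $g:A\to B$ and coprojector $h:B\to A$, if for all $a,b\in A$ one has $a+_A b=h(g(a)+_B g(b))$ and $a\times_A b=h(g(a)\times_B g(b))$. On $[-M,M]$: $a\boxplus b$ equals $a+b$ if $a+b\in[-M,M]$, $M$ if $a+b>M$, and $-M$ if $a+b<-M$; $a\boxtimes b$ equals $a\times b$ if $a\times b\in[-M,M]$, $M$ if $a\times b>M$, and $-M$ if $a\times b<-M$. Here $+,\times,\le$ are the usual operations and order on $\mathbb{R}$. -}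

module Defs where

open import Level using (0ℓ; suc)
open import Data.Nat as ℕ using (ℕ)
import Data.Nat.Properties as ℕ
open import Data.Rational as ℚ using (ℚ; 0ℚ; 1ℚ; ½)
import Data.Rational.Properties as ℚ
open import Data.Product using (∃; ∃-syntax; _×_; _,_; proj₁; proj₂; uncurry)
open import Data.Unit using (tt)
open import Data.Sum using (inj₁; inj₂)
open import Algebra.Bundles using (CommutativeMonoid)
open import Algebra.Core using (Op₁; Op₂)
open import Algebra.Definitions using (Congruent₂)
open import Function.Bundles using (Func)
open import Function.Base using (_on_)
open import Relation.Unary using (Pred; U)
open import Relation.Binary.Core using (Rel)
open import Relation.Binary.Bundles using (Setoid)
open import Relation.Binary.Structures using (IsEquivalence; IsPartialOrder)
open import Relation.Binary.Definitions using (_Respects_)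
open import Relation.Binary.PropositionalEquality
  using (_≡_; refl; sym; trans; cong; cong₂; subst; subst₂)
import Relation.Binary.Construct.On as On
import Algebra.Properties.AbelianGroup as AbelianGroupProperties
import Algebra.Properties.CommutativeSemigroup as CommutativeSemigroupProperties

------------------------------------------------------------------------
-- Rational estimates

module RationalEstimates where
  dist : ℚ → ℚ → ℚ
  dist p q = ℚ.∣ p ℚ.- q ∣

  open AbelianGroupProperties ℚ.+-0-abelianGroup
    using (⁻¹-anti-homo‿-; ⁻¹-∙-comm; xyx⁻¹≈y)
  open CommutativeSemigroupProperties
    (CommutativeMonoid.commutativeSemigroup ℚ.+-0-commutativeMonoid)
    using (interchange)

  p-q+q : ∀ p q → (p ℚ.- q) ℚ.+ q ≡ p
  p-q+q p q = trans (ℚ.+-assoc p (ℚ.- q) q)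
    (trans (cong (p ℚ.+_) (ℚ.+-inverseˡ q)) (ℚ.+-identityʳ p))

  q+[p-q] : ∀ p q → q ℚ.+ (p ℚ.- q) ≡ p
  q+[p-q] p q = trans (ℚ.+-comm q (p ℚ.- q)) (p-q+q p q)

  telescope : ∀ p q r → (p ℚ.- q) ℚ.+ (q ℚ.- r) ≡ p ℚ.- r
  telescope p q r = trans (sym (ℚ.+-assoc (p ℚ.- q) q (ℚ.- r)))
    (cong (ℚ._- r) (p-q+q p q))

  -‿+-interchange : ∀ a b c d → (a ℚ.- c) ℚ.+ (b ℚ.- d) ≡ (a ℚ.+ b) ℚ.- (c ℚ.+ d)
  -‿+-interchange a b c d = trans (interchange a (ℚ.- c) b (ℚ.- d))
    (cong ((a ℚ.+ b) ℚ.+_) (⁻¹-∙-comm c d))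

  *-distribˡ-- : ∀ p q r → p ℚ.* (q ℚ.- r) ≡ p ℚ.* q ℚ.- p ℚ.* r
  *-distribˡ-- p q r = trans (ℚ.*-distribˡ-+ p q (ℚ.- r))
    (cong (p ℚ.* q ℚ.+_) (sym (ℚ.neg-distribʳ-* p r)))

  *-telescope : ∀ a b c d →
    a ℚ.* (b ℚ.- d) ℚ.+ d ℚ.* (a ℚ.- c) ≡ a ℚ.* b ℚ.- c ℚ.* d
  *-telescope a b c d = trans
    (cong₂ ℚ._+_ (*-distribˡ-- a b d)
      (trans (*-distribˡ-- d a c) (cong₂ ℚ._-_ (ℚ.*-comm d a) (ℚ.*-comm d c))))
    (telescope (a ℚ.* b) (a ℚ.* d) (c ℚ.* d))

  ≤∣∣ : ∀ p → p ℚ.≤ ℚ.∣ p ∣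
  ≤∣∣ p with ℚ.≤-total 0ℚ p
  ... | inj₁ 0≤p = ℚ.≤-reflexive (sym (ℚ.0≤p⇒∣p∣≡p 0≤p))
  ... | inj₂ p≤0 = ℚ.≤-trans p≤0 (ℚ.0≤∣p∣ p)

  dist-sym : ∀ p q → dist p q ≡ dist q p
  dist-sym p q = trans (sym (ℚ.∣-p∣≡∣p∣ (p ℚ.- q)))
    (cong ℚ.∣_∣ (⁻¹-anti-homo‿- p q))

  dist-refl : ∀ p → dist p p ≡ 0ℚ
  dist-refl p = cong ℚ.∣_∣ (ℚ.+-inverseʳ p)

  dist-tri : ∀ p q r → dist p r ℚ.≤ dist p q ℚ.+ dist q r
  dist-tri p q r = subst (ℚ._≤ dist p q ℚ.+ dist q r)
    (cong ℚ.∣_∣ (telescope p q r))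
    (ℚ.∣p+q∣≤∣p∣+∣q∣ (p ℚ.- q) (q ℚ.- r))

  dist<⇒< : ∀ p q {ε} → dist p q ℚ.< ε → p ℚ.< q ℚ.+ ε
  dist<⇒< p q {ε} h = subst (ℚ._< q ℚ.+ ε)
    (q+[p-q] p q)
    (ℚ.+-monoʳ-< q (ℚ.≤-<-trans (≤∣∣ (p ℚ.- q)) h))

  dist<⇒> : ∀ p q {ε} → dist p q ℚ.< ε → q ℚ.< p ℚ.+ ε
  dist<⇒> p q {ε} h = dist<⇒< q p (subst (ℚ._< ε) (dist-sym p q) h)

  <+⇒-< : ∀ p q {ε} → p ℚ.< q ℚ.+ ε → p ℚ.- q ℚ.< ε
  <+⇒-< p q {ε} h = subst (p ℚ.- q ℚ.<_)
    (xyx⁻¹≈y q ε)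
    (ℚ.+-monoˡ-< (ℚ.- q) h)

  close : ∀ p q {ε} → p ℚ.< q ℚ.+ ε → q ℚ.< p ℚ.+ ε → dist p q ℚ.< ε
  close p q {ε} h k with ℚ.≤-total q p
  ... | inj₁ q≤p = subst (ℚ._< ε) (sym (ℚ.0≤p⇒∣p∣≡p
                     (subst (ℚ._≤ p ℚ.- q) (ℚ.+-inverseʳ q) (ℚ.+-monoˡ-≤ (ℚ.- q) q≤p))))
                     (<+⇒-< p q h)
  ... | inj₂ p≤q = subst (ℚ._< ε) (trans (sym (ℚ.0≤p⇒∣p∣≡p
                     (subst (ℚ._≤ q ℚ.- p) (ℚ.+-inverseʳ p) (ℚ.+-monoˡ-≤ (ℚ.- p) p≤q))))
                     (dist-sym q p))
                     (<+⇒-< q p k)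

  <+ : ∀ {ε} p → 0ℚ ℚ.< ε → p ℚ.< p ℚ.+ ε
  <+ {ε} p 0<ε = subst (ℚ._< p ℚ.+ ε) (ℚ.+-identityʳ p) (ℚ.+-monoʳ-< p 0<ε)

  0<+ : ∀ {p q} → 0ℚ ℚ.< p → 0ℚ ℚ.< q → 0ℚ ℚ.< p ℚ.+ q
  0<+ {p} {q} 0<p 0<q = ℚ.+-mono-< {0ℚ} {p} {0ℚ} {q} 0<p 0<q

  halves : ∀ ε → ½ ℚ.* ε ℚ.+ ½ ℚ.* ε ≡ ε
  halves ε = trans (sym (ℚ.*-distribʳ-+ ε ½ ½)) (ℚ.*-identityˡ ε)

  0<½* : ∀ {ε} → 0ℚ ℚ.< ε → 0ℚ ℚ.< ½ ℚ.* ε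
  0<½* {ε} 0<ε = subst (ℚ._< ½ ℚ.* ε) (ℚ.*-zeroʳ ½) (ℚ.*-monoʳ-<-pos ½ 0<ε)

  +-close : ∀ a b c d {ε} → dist a c ℚ.< ½ ℚ.* ε → dist b d ℚ.< ½ ℚ.* ε →
            dist (a ℚ.+ b) (c ℚ.+ d) ℚ.< ε
  +-close a b c d {ε} h k = ℚ.≤-<-trans
    (subst (ℚ._≤ dist a c ℚ.+ dist b d)
      (cong ℚ.∣_∣ (-‿+-interchange a b c d))
      (ℚ.∣p+q∣≤∣p∣+∣q∣ (a ℚ.- c) (b ℚ.- d)))
    (subst (dist a c ℚ.+ dist b d ℚ.<_) (halves ε) (ℚ.+-mono-< h k))

  *-close : ∀ {K ε} → 0ℚ ℚ.< K → 0ℚ ℚ.< ε →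
            ∃[ δ ] 0ℚ ℚ.< δ × (∀ a b c d → ℚ.∣ a ∣ ℚ.< K → ℚ.∣ d ∣ ℚ.< K →
              dist a c ℚ.< δ → dist b d ℚ.< δ → dist (a ℚ.* b) (c ℚ.* d) ℚ.< ε)
  *-close {K} {ε} 0<K 0<ε = δ , 0<δ , bound
    where
    instance
      posK : ℚ.Positive K
      posK = ℚ.positive 0<K
      nzK : ℚ.NonZero K
      nzK = ℚ.pos⇒nonZero K
    δ : ℚ
    δ = ℚ.1/ K ℚ.* (½ ℚ.* ε)
    0<δ : 0ℚ ℚ.< δ
    0<δ = subst (ℚ._< δ) (ℚ.*-zeroʳ (ℚ.1/ K))
      (ℚ.*-monoʳ-<-pos (ℚ.1/ K) {{ℚ.1/pos⇒pos K}} (0<½* 0<ε))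
    instance
      posδ : ℚ.Positive δ
      posδ = ℚ.positive 0<δ
    K*δ : K ℚ.* δ ≡ ½ ℚ.* ε
    K*δ = trans (sym (ℚ.*-assoc K (ℚ.1/ K) (½ ℚ.* ε)))
      (trans (cong (ℚ._* (½ ℚ.* ε)) (ℚ.*-inverseʳ K)) (ℚ.*-identityˡ (½ ℚ.* ε)))
    term : ∀ a u → ℚ.∣ a ∣ ℚ.< K → ℚ.∣ u ∣ ℚ.< δ → ℚ.∣ a ℚ.* u ∣ ℚ.< ½ ℚ.* ε
    term a u a<K u<δ = subst₂ ℚ._<_ (sym (ℚ.∣p*q∣≡∣p∣*∣q∣ a u)) K*δ
      (ℚ.≤-<-trans
        (ℚ.*-monoˡ-≤-nonNeg ℚ.∣ a ∣ {{ℚ.nonNegative (ℚ.0≤∣p∣ a)}} (ℚ.<⇒≤ u<δ))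
        (ℚ.*-monoˡ-<-pos δ a<K))
    bound : ∀ a b c d → ℚ.∣ a ∣ ℚ.< K → ℚ.∣ d ∣ ℚ.< K →
            dist a c ℚ.< δ → dist b d ℚ.< δ → dist (a ℚ.* b) (c ℚ.* d) ℚ.< ε
    bound a b c d a<K d<K ac bd = ℚ.≤-<-trans
      (subst (ℚ._≤ ℚ.∣ a ℚ.* (b ℚ.- d) ∣ ℚ.+ ℚ.∣ d ℚ.* (a ℚ.- c) ∣)
        (cong ℚ.∣_∣ (*-telescope a b c d))
        (ℚ.∣p+q∣≤∣p∣+∣q∣ (a ℚ.* (b ℚ.- d)) (d ℚ.* (a ℚ.- c))))
      (subst (ℚ.∣ a ℚ.* (b ℚ.- d) ∣ ℚ.+ ℚ.∣ d ℚ.* (a ℚ.- c) ∣ ℚ.<_) (halves ε)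
        (ℚ.+-mono-< (term a (b ℚ.- d) a<K bd) (term d (a ℚ.- c) d<K ac)))

  ⊔-lub-< : ∀ p q {r} → p ℚ.< r → q ℚ.< r → p ℚ.⊔ q ℚ.< r
  ⊔-lub-< p q {r} p<r q<r with ℚ.≤-total p q
  ... | inj₁ p≤q = subst (ℚ._< r) (sym (ℚ.p≤q⇒p⊔q≡q p≤q)) q<r
  ... | inj₂ q≤p = subst (ℚ._< r) (sym (ℚ.p≥q⇒p⊔q≡p q≤p)) p<r

  -neg : ∀ p q → dist (ℚ.- p) (ℚ.- q) ≡ dist p q
  -neg p q = trans (cong ℚ.∣_∣ (⁻¹-∙-comm p (ℚ.- q)))
    (ℚ.∣-p∣≡∣p∣ (p ℚ.- q))

  <⊔+ˡ : ∀ {a ε} c d → a ℚ.< c ℚ.+ ε → a ℚ.< (c ℚ.⊔ d) ℚ.+ ε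
  <⊔+ˡ {ε = ε} c d h = ℚ.<-≤-trans h (ℚ.+-monoˡ-≤ ε (ℚ.p≤p⊔q c d))

  <⊔+ʳ : ∀ {a ε} c d → a ℚ.< d ℚ.+ ε → a ℚ.< (c ℚ.⊔ d) ℚ.+ ε
  <⊔+ʳ {ε = ε} c d h = ℚ.<-≤-trans h (ℚ.+-monoˡ-≤ ε (ℚ.p≤q⊔p c d))

  <⊓+ : ∀ {a ε} c d → a ℚ.< c ℚ.+ ε → a ℚ.< d ℚ.+ ε → a ℚ.< (c ℚ.⊓ d) ℚ.+ ε
  <⊓+ {a} {ε} c d h k with ℚ.≤-total c d
  ... | inj₁ c≤d = subst (λ z → a ℚ.< z ℚ.+ ε) (sym (ℚ.p≤q⇒p⊓q≡p c≤d)) h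
  ... | inj₂ d≤c = subst (λ z → a ℚ.< z ℚ.+ ε) (sym (ℚ.p≥q⇒p⊓q≡q d≤c)) k

  ⊔-close : ∀ a b c d {ε} → dist a c ℚ.< ε → dist b d ℚ.< ε →
            dist (a ℚ.⊔ b) (c ℚ.⊔ d) ℚ.< ε
  ⊔-close a b c d h k = close (a ℚ.⊔ b) (c ℚ.⊔ d)
    (⊔-lub-< a b (<⊔+ˡ c d (dist<⇒< a c h)) (<⊔+ʳ c d (dist<⇒< b d k)))
    (⊔-lub-< c d (<⊔+ˡ a b (dist<⇒> a c h)) (<⊔+ʳ a b (dist<⇒> b d k)))

  ⊓-close : ∀ a b c d {ε} → dist a c ℚ.< ε → dist b d ℚ.< ε →
            dist (a ℚ.⊓ b) (c ℚ.⊓ d) ℚ.< ε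
  ⊓-close a b c d h k = close (a ℚ.⊓ b) (c ℚ.⊓ d)
    (<⊓+ c d (ℚ.≤-<-trans (ℚ.p⊓q≤p a b) (dist<⇒< a c h))
             (ℚ.≤-<-trans (ℚ.p⊓q≤q a b) (dist<⇒< b d k)))
    (<⊓+ a b (ℚ.≤-<-trans (ℚ.p⊓q≤p c d) (dist<⇒> a c h))
             (ℚ.≤-<-trans (ℚ.p⊓q≤q c d) (dist<⇒> b d k)))

open RationalEstimates

------------------------------------------------------------------------
-- The real numbers: Cauchy sequences of rationals, with equality of reals
-- as a setoid equality

Eventually : Pred (Pred ℕ 0ℓ) 0ℓ
Eventually P = ∃[ N ] ∀ n → N ℕ.≤ n → P n

module EventuallyProperties where
  ev-map : ∀ {P Q : Pred ℕ 0ℓ} → (∀ n → P n → Q n) → Eventually P → Eventually Q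
  ev-map f (N , h) = N , λ n N≤n → f n (h n N≤n)

  ev-zip : ∀ {P Q R : Pred ℕ 0ℓ} → (∀ n → P n → Q n → R n) →
           Eventually P → Eventually Q → Eventually R
  ev-zip f (N , h) (N′ , k) = N ℕ.⊔ N′ , λ n le →
    f n (h n (ℕ.m⊔n≤o⇒m≤o N N′ le)) (k n (ℕ.m⊔n≤o⇒n≤o N N′ le))

open EventuallyProperties

IsCauchy : Pred (ℕ → ℚ) 0ℓ
IsCauchy s = ∀ ε → 0ℚ ℚ.< ε →
  ∃[ N ] ∀ m n → N ℕ.≤ m → N ℕ.≤ n → ℚ.∣ s m ℚ.- s n ∣ ℚ.< ε

record ℝ : Set where
  constructor mkℝ
  field
    seq    : ℕ → ℚ
    cauchy : IsCauchy seq

open ℝ public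

infix 4 _≈_ _≤_ _<_
infixl 6 _+_
infixl 7 _*_
infix 8 -_

-- The relations are records so that the reals they relate can be inferred.

record _≈_ (x y : ℝ) : Set where
  constructor mk≈
  field
    ≈-at : ∀ ε → 0ℚ ℚ.< ε → Eventually λ n → ℚ.∣ seq x n ℚ.- seq y n ∣ ℚ.< ε

record _≤_ (x y : ℝ) : Set where
  constructor mk≤
  field
    ≤-at : ∀ ε → 0ℚ ℚ.< ε → Eventually λ n → seq x n ℚ.< seq y n ℚ.+ ε

record _<_ (x y : ℝ) : Set where
  constructor mk<
  field
    gap       : ℚ
    gap-pos   : 0ℚ ℚ.< gap
    separated : Eventually λ n → seq x n ℚ.+ gap ℚ.< seq y n

open _≈_ public
open _≤_ public
open _<_ public

private
  cauchy₂ : ∀ (x y : ℝ) (u : ℕ → ℚ) {δ ε} →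
            (∀ m n → dist (seq x m) (seq x n) ℚ.< δ → dist (seq y m) (seq y n) ℚ.< δ →
              dist (u m) (u n) ℚ.< ε) →
            0ℚ ℚ.< δ → ∃[ N ] ∀ m n → N ℕ.≤ m → N ℕ.≤ n → dist (u m) (u n) ℚ.< ε
  cauchy₂ x y u f 0<δ with cauchy x _ 0<δ | cauchy y _ 0<δ
  ... | N , h | N′ , k = N ℕ.⊔ N′ , λ m n N≤m N≤n → f m n
    (h m n (ℕ.m⊔n≤o⇒m≤o N N′ N≤m) (ℕ.m⊔n≤o⇒m≤o N N′ N≤n))
    (k m n (ℕ.m⊔n≤o⇒n≤o N N′ N≤m) (ℕ.m⊔n≤o⇒n≤o N N′ N≤n))

  bounded : ∀ x → ∃[ K ] 0ℚ ℚ.< K × Eventually λ n → ℚ.∣ seq x n ∣ ℚ.< K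
  bounded x with cauchy x 1ℚ (ℚ.positive⁻¹ 1ℚ)
  ... | N , h = ℚ.∣ a ∣ ℚ.+ 1ℚ
              , ℚ.+-mono-≤-< (ℚ.0≤∣p∣ a) (ℚ.positive⁻¹ 1ℚ)
              , N , λ n N≤n → ℚ.≤-<-trans
                  (subst (λ z → ℚ.∣ z ∣ ℚ.≤ ℚ.∣ a ∣ ℚ.+ dist (seq x n) a)
                    (q+[p-q] (seq x n) a)
                    (ℚ.∣p+q∣≤∣p∣+∣q∣ a (seq x n ℚ.- a)))
                  (ℚ.+-monoʳ-< ℚ.∣ a ∣ (h n N N≤n ℕ.≤-refl))
    where
    a : ℚ
    a = seq x N

  bounded₂ : ∀ x y → ∃[ K ] 0ℚ ℚ.< K ×
             Eventually λ n → ℚ.∣ seq x n ∣ ℚ.< K × ℚ.∣ seq y n ∣ ℚ.< K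
  bounded₂ x y with bounded x | bounded y
  ... | K , 0<K , bx | L , 0<L , by = K ℚ.+ L , 0<+ {K} {L} 0<K 0<L ,
    ev-zip (λ n h k → ℚ.<-trans h (<+ K 0<L)
                    , ℚ.<-trans k (subst (L ℚ.<_) (ℚ.+-comm L K) (<+ L 0<K))) bx by

fromℚ : ℚ → ℝ
fromℚ q = mkℝ (λ _ → q) λ ε 0<ε → 0 , λ _ _ _ _ → subst (ℚ._< ε) (sym (dist-refl q)) 0<ε

1ℝ : ℝ
1ℝ = fromℚ 1ℚ

-_ : Op₁ ℝ
- x = mkℝ (λ n → ℚ.- seq x n) λ ε 0<ε →
  let N , h = cauchy x ε 0<ε
  in N , λ m n N≤m N≤n → subst (ℚ._< ε) (sym (-neg (seq x m) (seq x n))) (h m n N≤m N≤n)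

_+_ : Op₂ ℝ
x + y = mkℝ (λ n → seq x n ℚ.+ seq y n) λ ε 0<ε →
  cauchy₂ x y (λ n → seq x n ℚ.+ seq y n)
    (λ m n → +-close (seq x m) (seq y m) (seq x n) (seq y n)) (0<½* 0<ε)

_*_ : Op₂ ℝ
x * y = mkℝ (λ n → seq x n ℚ.* seq y n) *-cauchy
  where
  *-cauchy : IsCauchy (λ n → seq x n ℚ.* seq y n)
  *-cauchy ε 0<ε =
    let K , 0<K , N , b = bounded₂ x y
        δ , 0<δ , c = *-close 0<K 0<ε
        N₁ , h = cauchy x δ 0<δ
        N₂ , k = cauchy y δ 0<δ
        N′ = N₁ ℕ.⊔ N₂
    in N ℕ.⊔ N′ , λ m n le le′ →
      let p = ℕ.m⊔n≤o⇒n≤o N N′ le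
          p′ = ℕ.m⊔n≤o⇒n≤o N N′ le′
      in c (seq x m) (seq y m) (seq x n) (seq y n)
           (proj₁ (b m (ℕ.m⊔n≤o⇒m≤o N N′ le)))
           (proj₂ (b n (ℕ.m⊔n≤o⇒m≤o N N′ le′)))
           (h m n (ℕ.m⊔n≤o⇒m≤o N₁ N₂ p) (ℕ.m⊔n≤o⇒m≤o N₁ N₂ p′))
           (k m n (ℕ.m⊔n≤o⇒n≤o N₁ N₂ p) (ℕ.m⊔n≤o⇒n≤o N₁ N₂ p′))

≈-isEquivalence : IsEquivalence _≈_
≈-isEquivalence = record
  { refl  = λ {x} → mk≈ λ ε 0<ε →
      0 , λ n _ → subst (ℚ._< ε) (sym (dist-refl (seq x n))) 0<ε
  ; sym   = λ {x} {y} h → mk≈ λ ε 0<ε →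
      ev-map (λ n → subst (ℚ._< ε) (dist-sym (seq x n) (seq y n))) (≈-at h ε 0<ε)
  ; trans = λ {x} {y} {z} h k → mk≈ λ ε 0<ε →
      ev-zip (λ n p q → ℚ.≤-<-trans (dist-tri (seq x n) (seq y n) (seq z n))
               (subst (dist (seq x n) (seq y n) ℚ.+ dist (seq y n) (seq z n) ℚ.<_)
                 (halves ε) (ℚ.+-mono-< p q)))
             (≈-at h (½ ℚ.* ε) (0<½* 0<ε)) (≈-at k (½ ℚ.* ε) (0<½* 0<ε))
  }

≤-isPartialOrder : IsPartialOrder _≈_ _≤_
≤-isPartialOrder = record
  { isPreorder = record
    { isEquivalence = ≈-isEquivalence
    ; reflexive     = λ {x} {y} h → mk≤ λ ε 0<ε →
        ev-map (λ n → dist<⇒< (seq x n) (seq y n)) (≈-at h ε 0<ε)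
    ; trans         = λ {x} {y} {z} h k → mk≤ λ ε 0<ε →
        ev-zip (λ n p q → ℚ.<-trans p
                 (subst (seq y n ℚ.+ ½ ℚ.* ε ℚ.<_)
                   (trans (ℚ.+-assoc (seq z n) (½ ℚ.* ε) (½ ℚ.* ε))
                          (cong (seq z n ℚ.+_) (halves ε)))
                   (ℚ.+-monoˡ-< (½ ℚ.* ε) q)))
               (≤-at h (½ ℚ.* ε) (0<½* 0<ε)) (≤-at k (½ ℚ.* ε) (0<½* 0<ε))
    }
  ; antisym = λ {x} {y} h k → mk≈ λ ε 0<ε →
      ev-zip (λ n → close (seq x n) (seq y n)) (≤-at h ε 0<ε) (≤-at k ε 0<ε)
  }

+-cong : Congruent₂ _≈_ _+_
+-cong {x} {x′} {y} {y′} h k = mk≈ λ ε 0<ε →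
  ev-zip (λ n → +-close (seq x n) (seq y n) (seq x′ n) (seq y′ n))
    (≈-at h (½ ℚ.* ε) (0<½* 0<ε)) (≈-at k (½ ℚ.* ε) (0<½* 0<ε))

*-cong : Congruent₂ _≈_ _*_
*-cong {x} {x′} {y} {y′} h k = mk≈ λ ε 0<ε →
  let K , 0<K , b = bounded₂ x y′
      δ , 0<δ , c = *-close 0<K 0<ε
  in ev-zip (λ n (a , d) → uncurry (c (seq x n) (seq y n) (seq x′ n) (seq y′ n) a d)) b
       (ev-zip (λ _ → _,_) (≈-at h δ 0<δ) (≈-at k δ 0<δ))

private
  module ≈ = IsEquivalence ≈-isEquivalence
  module ≤ = IsPartialOrder ≤-isPartialOrder

------------------------------------------------------------------------
-- Abstract prearithmetics

-- A subset A ⊂ ℝ is a predicate; its elements are pairs of a real and a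
-- membership proof, compared through the real alone.
record Prearithmetic : Set (suc 0ℓ) where
  field
    A      : Pred ℝ 0ℓ
    A-resp : A Respects _≈_

  Carrier : Set
  Carrier = ∃ A

  _≈ᴬ_ : Rel Carrier 0ℓ
  _≈ᴬ_ = _≈_ on proj₁

  field
    _+ᴬ_           : Op₂ Carrier
    _×ᴬ_           : Op₂ Carrier
    _≤ᴬ_           : Rel Carrier 0ℓ
    +ᴬ-cong        : Congruent₂ _≈ᴬ_ _+ᴬ_
    ×ᴬ-cong        : Congruent₂ _≈ᴬ_ _×ᴬ_
    isPartialOrder : IsPartialOrder _≈ᴬ_ _≤ᴬ_

  setoid : Setoid 0ℓ 0ℓ
  setoid = record
    { Carrier       = Carrier
    ; _≈_           = _≈ᴬ_
    ; isEquivalence = On.isEquivalence proj₁ ≈-isEquivalence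
    }

WeaklyProjective : (𝐀 𝐁 : Prearithmetic) →
  Func (Prearithmetic.setoid 𝐀) (Prearithmetic.setoid 𝐁) →
  Func (Prearithmetic.setoid 𝐁) (Prearithmetic.setoid 𝐀) → Set
WeaklyProjective 𝐀 𝐁 projector coprojector =
  (∀ a b → (a A.+ᴬ b) A.≈ᴬ h (g a B.+ᴬ g b)) ×
  (∀ a b → (a A.×ᴬ b) A.≈ᴬ h (g a B.×ᴬ g b))
  where
  module A = Prearithmetic 𝐀
  module B = Prearithmetic 𝐁
  open Func projector   using () renaming (to to g)
  open Func coprojector using () renaming (to to h)

𝐑 : Prearithmetic
𝐑 = record
  { A              = U
  ; A-resp         = λ _ _ → tt
  ; _+ᴬ_           = λ (x , _) (y , _) → x + y , tt
  ; _×ᴬ_           = λ (x , _) (y , _) → x * y , tt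
  ; _≤ᴬ_           = _≤_ on proj₁
  ; +ᴬ-cong        = λ {x} {y} {u} {v} → +-cong {proj₁ x} {proj₁ y} {proj₁ u} {proj₁ v}
  ; ×ᴬ-cong        = λ {x} {y} {u} {v} → *-cong {proj₁ x} {proj₁ y} {proj₁ u} {proj₁ v}
  ; isPartialOrder = On.isPartialOrder proj₁ ≤-isPartialOrder
  }

------------------------------------------------------------------------
-- Truncation to [-M, M]

InInterval : ℝ → Pred ℝ 0ℓ
InInterval M x = - M ≤ x × x ≤ M

Interval : ℝ → Set
Interval M = ∃ (InInterval M)

-- The order on ℝ is not decidable, so a definition by the three cases
-- x ∈ [-M, M], x > M, x < -M is rendered by its defining equations.  They
-- determine y up to _≈_, since _≈_ is ¬¬-stable, and for 1 ≤ M they are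
-- satisfied by y = max (-M) (min x M): see truncation and truncatedOp below.
record PiecewiseTruncation (M x y : ℝ) : Set where
  field
    inside : InInterval M x → y ≈ x
    above  : M < x → y ≈ M
    below  : x < - M → y ≈ - M

-- ⊞ is a TruncatedOp M _+_ and ⊠ is a TruncatedOp M _*_.
record TruncatedOp (M : ℝ) (_∙_ : Op₂ ℝ) : Set where
  field
    op        : Op₂ (Interval M)
    op-cong   : Congruent₂ (_≈_ on proj₁) op
    piecewise : ∀ a b → PiecewiseTruncation M (proj₁ a ∙ proj₁ b) (proj₁ (op a b))

module _ (M : ℝ) (⊞ : TruncatedOp M _+_) (⊠ : TruncatedOp M _*_) where

  𝐀[-M,M] : Prearithmetic
  𝐀[-M,M] = record
    { A              = InInterval M
    ; A-resp         = λ x≈y (l , u) → ≤.trans l (≤.reflexive x≈y)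
                                     , ≤.trans (≤.reflexive (≈.sym x≈y)) u
    ; _+ᴬ_           = TruncatedOp.op ⊞
    ; _×ᴬ_           = TruncatedOp.op ⊠
    ; _≤ᴬ_           = _≤_ on proj₁
    ; +ᴬ-cong        = TruncatedOp.op-cong ⊞
    ; ×ᴬ-cong        = TruncatedOp.op-cong ⊠
    ; isPartialOrder = On.isPartialOrder proj₁ ≤-isPartialOrder
    }

  s : Func (Prearithmetic.setoid 𝐀[-M,M]) (Prearithmetic.setoid 𝐑)
  s = record { to = λ (a , _) → a , tt ; cong = λ a≈b → a≈b }

  IsTruncation : Pred (Func (Prearithmetic.setoid 𝐑) (Prearithmetic.setoid 𝐀[-M,M])) 0ℓ
  IsTruncation t = ∀ a → PiecewiseTruncation M (proj₁ a) (proj₁ (Func.to t a))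

------------------------------------------------------------------------
-- Existence of the truncated operations and of the coprojector

private
  clamp : ℝ → ℝ → ℝ
  clamp M x = mkℝ c λ ε 0<ε → cauchy₂ M x c (λ m n hM hx →
      ⊔-close (ℚ.- seq M m) (seq x m ℚ.⊓ seq M m) (ℚ.- seq M n) (seq x n ℚ.⊓ seq M n)
        (subst (ℚ._< ε) (sym (-neg (seq M m) (seq M n))) hM)
        (⊓-close (seq x m) (seq M m) (seq x n) (seq M n) hx hM))
    0<ε
    where
    c : ℕ → ℚ
    c n = (ℚ.- seq M n) ℚ.⊔ (seq x n ℚ.⊓ seq M n)

  clamp-cong : ∀ M {x y} → x ≈ y → clamp M x ≈ clamp M y
  clamp-cong M {x} {y} x≈y = mk≈ λ ε 0<ε → ev-map (λ n hx →
      ⊔-close (ℚ.- seq M n) (seq x n ℚ.⊓ seq M n) (ℚ.- seq M n) (seq y n ℚ.⊓ seq M n)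
        (subst (ℚ._< ε) (sym (dist-refl (ℚ.- seq M n))) 0<ε)
        (⊓-close (seq x n) (seq M n) (seq y n) (seq M n) hx
          (subst (ℚ._< ε) (sym (dist-refl (seq M n))) 0<ε)))
    (≈-at x≈y ε 0<ε)

  -M≤M : ∀ {M} → 1ℝ ≤ M → Eventually λ n → ℚ.- seq M n ℚ.≤ seq M n
  -M≤M {M} 1≤M = ev-map (λ n h →
      let 0≤M = ℚ.≮⇒≥ λ M<0 → ℚ.<-asym h (ℚ.+-monoˡ-< 1ℚ {seq M n} {0ℚ} M<0)
      in ℚ.≤-trans (ℚ.neg-antimono-≤ 0≤M) 0≤M)
    (≤-at 1≤M 1ℚ (ℚ.positive⁻¹ 1ℚ))

  clamp∈ : ∀ {M} → 1ℝ ≤ M → ∀ x → InInterval M (clamp M x)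
  clamp∈ {M} 1≤M x =
    mk≤ (λ ε 0<ε → 0 , λ n _ →
      ℚ.≤-<-trans (ℚ.p≤p⊔q (ℚ.- seq M n) (seq x n ℚ.⊓ seq M n))
                  (<+ (seq (clamp M x) n) 0<ε)) ,
    mk≤ (λ ε 0<ε → ev-map (λ n h →
        ℚ.≤-<-trans (ℚ.⊔-lub h (ℚ.p⊓q≤q (seq x n) (seq M n))) (<+ (seq M n) 0<ε))
      (-M≤M 1≤M))

  clamp-piecewise : ∀ {M} → 1ℝ ≤ M → ∀ x → PiecewiseTruncation M x (clamp M x)
  clamp-piecewise {M} 1≤M x = record
    { inside = λ (l , u) → mk≈ λ ε 0<ε → ev-zip (λ n hl hu →
          close (seq (clamp M x) n) (seq x n)
            (⊔-lub-< (ℚ.- seq M n) (seq x n ℚ.⊓ seq M n) hl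
              (ℚ.≤-<-trans (ℚ.p⊓q≤p (seq x n) (seq M n)) (<+ (seq x n) 0<ε)))
            (<⊔+ʳ (ℚ.- seq M n) (seq x n ℚ.⊓ seq M n)
              (<⊓+ (seq x n) (seq M n) (<+ (seq x n) 0<ε) hu)))
        (≤-at l ε 0<ε) (≤-at u ε 0<ε)
    ; above = λ M<x → mk≈ λ ε 0<ε → ev-zip (λ n h -M≤M →
          subst (λ z → dist z (seq M n) ℚ.< ε)
            (sym (trans (cong (ℚ.- seq M n ℚ.⊔_)
                          (ℚ.p≥q⇒p⊓q≡q (ℚ.<⇒≤ (ℚ.<-trans (<+ (seq M n) (gap-pos M<x)) h))))
                        (ℚ.p≤q⇒p⊔q≡q -M≤M)))
            (subst (ℚ._< ε) (sym (dist-refl (seq M n))) 0<ε))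
        (separated M<x) (-M≤M 1≤M)
    ; below = λ x<-M → mk≈ λ ε 0<ε → ev-map (λ n h →
          subst (λ z → dist z (ℚ.- seq M n) ℚ.< ε)
            (sym (ℚ.p≥q⇒p⊔q≡p (ℚ.≤-trans (ℚ.p⊓q≤p (seq x n) (seq M n))
                                (ℚ.<⇒≤ (ℚ.<-trans (<+ (seq x n) (gap-pos x<-M)) h)))))
            (subst (ℚ._< ε) (sym (dist-refl (ℚ.- seq M n))) 0<ε))
        (separated x<-M)
    }

truncatedOp : ∀ {M} → 1ℝ ≤ M → {_∙_ : Op₂ ℝ} → Congruent₂ _≈_ _∙_ → TruncatedOp M _∙_
truncatedOp {M} 1≤M {_∙_} ∙-cong = record
  { op        = λ (a , _) (b , _) → clamp M (a ∙ b) , clamp∈ 1≤M (a ∙ b)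
  ; op-cong   = λ {x} {y} {u} {v} x≈y u≈v →
      clamp-cong M (∙-cong {proj₁ x} {proj₁ y} {proj₁ u} {proj₁ v} x≈y u≈v)
  ; piecewise = λ (a , _) (b , _) → clamp-piecewise 1≤M (a ∙ b)
  }

truncation : ∀ {M} → 1ℝ ≤ M → ∀ ⊞ ⊠ → ∃ (IsTruncation M ⊞ ⊠)
truncation {M} 1≤M ⊞ ⊠ =
    record { to = λ (a , _) → clamp M a , clamp∈ 1≤M a ; cong = λ {x} {y} → clamp-cong M {proj₁ x} {proj₁ y} }
  , λ (a , _) → clamp-piecewise 1≤M a

{-# OPTIONS --safe #-}

-- Both a ⊞ b and t (a + b) satisfy the piecewise equations of truncation at
-- the same real x, so it is enough that these equations determine their
-- solution.  Equality of reals is ¬¬-stable, hence one may assume that two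
-- solutions differ; then x > M and x < -M are both impossible, which puts x
-- in [-M, M], where both solutions equal x.

module Submission where

open import Defs
open import Function.Bundles using (Func)
open import Data.Empty using (⊥; ⊥-elim)
import Data.Nat.Properties as ℕ
open import Data.Product using (_,_; proj₁)
open import Data.Rational as ℚ using (ℚ; 0ℚ; ½)
import Data.Rational.Properties as ℚ
open import Data.Unit using (tt)
open import Relation.Binary.PropositionalEquality using (subst; sym)
open import Relation.Binary.Structures using (IsEquivalence; IsPartialOrder)
open import Relation.Nullary using (¬_; yes; no)

open RationalEstimates
open EventuallyProperties

private
  module ≈ = IsEquivalence ≈-isEquivalence
  module ≤ = IsPartialOrder ≤-isPartialOrder

<-irrefl : ∀ {x y} → x ≈ y → ¬ (x < y)
<-irrefl {x} {y} x≈y x<y = never (ev-zip {R = λ _ → ⊥}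
  (λ n d sep → ℚ.<-asym sep (dist<⇒> (seq x n) (seq y n) d))
  -- With the gap itself as tolerance, closeness and separation contradict each other at any common
  -- index.
  (≈-at x≈y (gap x<y) (gap-pos x<y)) (separated x<y))
  where
  never : Eventually (λ _ → ⊥) → ⊥
  never (N , h) = h N ℕ.≤-refl

-- Sampling y - x at one index beyond its modulus for ε/4 decides between
-- y - x > ε/4 and y - x < ε.
≮⇒≥ : ∀ {x y} → ¬ (x < y) → y ≤ x
≮⇒≥ {x} {y} x≮y = mk≤ bound
  where
  z : ℝ
  z = y + - x
  from-difference : ∀ n {r} → seq z n ℚ.< r → seq y n ℚ.< seq x n ℚ.+ r
  from-difference n {r} h = subst (ℚ._< seq x n ℚ.+ r)
    (q+[p-q] (seq y n) (seq x n)) (ℚ.+-monoʳ-< (seq x n) h)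
  bound : ∀ ε → 0ℚ ℚ.< ε → Eventually λ n → seq y n ℚ.< seq x n ℚ.+ ε
  bound ε 0<ε with cauchy z (½ ℚ.* (½ ℚ.* ε)) (0<½* (0<½* 0<ε))
  ... | N , h with seq z N ℚ.<? ½ ℚ.* ε
  -- Past `N`, `z` stays below ε/2 + ε/4, hence below ε.
  ... | yes small = N , λ n N≤n → from-difference n
          (ℚ.<-trans (dist<⇒< (seq z n) (seq z N) (h n N N≤n ℕ.≤-refl))
            (subst (seq z N ℚ.+ γ ℚ.<_) (halves ε) (ℚ.+-mono-< small γ<δ)))
    where
    γ δ : ℚ
    δ = ½ ℚ.* ε
    γ = ½ ℚ.* δ
    γ<δ : γ ℚ.< δ
    γ<δ = subst (γ ℚ.<_) (halves δ) (<+ γ (0<½* (0<½* 0<ε)))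
  -- Here `z` is at least ε/2 at `N` and varies by less than ε/4 afterwards, so ε/4 is a gap
  -- witnessing `x < y`.
  ... | no large = ⊥-elim (x≮y (mk< γ (0<½* (0<½* 0<ε)) (N , λ n N≤n →
          subst (seq x n ℚ.+ γ ℚ.<_) (q+[p-q] (seq y n) (seq x n))
            (ℚ.+-monoʳ-< (seq x n) (γ<z n (h N n ℕ.≤-refl N≤n))))))
    where
    γ : ℚ
    γ = ½ ℚ.* (½ ℚ.* ε)
    γ<z : ∀ n → dist (seq z N) (seq z n) ℚ.< γ → γ ℚ.< seq z n
    γ<z n d = ℚ.≰⇒> λ z≤γ → ℚ.<-irrefl (sym (halves (½ ℚ.* ε))) (ℚ.≤-<-trans (ℚ.≮⇒≥ large)
      (ℚ.<-≤-trans (dist<⇒< (seq z N) (seq z n) d) (ℚ.+-monoˡ-≤ γ z≤γ)))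

-- By antisymmetry it suffices to refute both strict inequalities; a refutation has goal `⊥`, so the
-- double negation can be opened there.
≈-stable : ∀ {x y} → ¬ ¬ (x ≈ y) → x ≈ y
≈-stable ¬¬x≈y = ≤.antisym
  (≮⇒≥ λ y<x → ¬¬x≈y λ x≈y → <-irrefl (≈.sym x≈y) y<x)
  (≮⇒≥ λ x<y → ¬¬x≈y λ x≈y → <-irrefl x≈y x<y)

truncation-unique : ∀ {M x y y′} → PiecewiseTruncation M x y →
                    PiecewiseTruncation M x y′ → y ≈ y′
truncation-unique p q = ≈-stable λ y≉y′ →
  let x∈ = ≮⇒≥ (λ x<-M → y≉y′ (≈.trans (P.below x<-M) (≈.sym (Q.below x<-M))))
         , ≮⇒≥ (λ M<x → y≉y′ (≈.trans (P.above M<x) (≈.sym (Q.above M<x))))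
  in y≉y′ (≈.trans (P.inside x∈) (≈.sym (Q.inside x∈)))
  where
  module P = PiecewiseTruncation p
  module Q = PiecewiseTruncation q

mainTheorem3 : (M : ℝ) → 1ℝ ≤ M →
    (⊞ : TruncatedOp M _+_) (⊠ : TruncatedOp M _*_) →
    (t : Func (Prearithmetic.setoid 𝐑) (Prearithmetic.setoid (𝐀[-M,M] M ⊞ ⊠))) →
    IsTruncation M ⊞ ⊠ t →
    WeaklyProjective (𝐀[-M,M] M ⊞ ⊠) 𝐑 (s M ⊞ ⊠) t
mainTheorem3 M _ ⊞ ⊠ t t-truncates =
    -- The projector keeps the underlying real, so `t` is applied to the very sum that `⊞`
    -- truncates.
    (λ a b → truncation-unique (TruncatedOp.piecewise ⊞ a b)
                               (t-truncates (proj₁ a + proj₁ b , tt)))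
  , (λ a b → truncation-unique (TruncatedOp.piecewise ⊠ a b)
                               (t-truncates (proj₁ a * proj₁ b , tt)))
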